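{- Let $\mathcal{R}$ be a partial applicative structure such that $\Sigma[\mathcal{R}]$ is posetal, and let $r\in\mathcal{R}$. Then for every $s\in\mathcal{R}$, either $r\cdot s=s$, or there exists a natural number $n$ such that $[r]^n(s)$ is undefined and $[r]^i(s)\neq[r]^j(s)$ for every $i,j<n$ such that $i\neq j$.
   Context: A partial applicative structure is a non-empty set $\mathcal{R}$ together with a partial binary function $\cdot:\mathcal{R}\times\mathcal{R}\rightharpoonup\mathcal{R}$; $t\downarrow$ means that $t$ is defined. For $r\in\mathcal{R}$, $[r]$ denotes the partial function from $\mathcal{R}$ to $\mathcal{R}$ with domain $\{x\in\mathcal{R}\mid r\cdot x\downarrow\}$ and $[r](x)=r\cdot x$; $[r]^n$ is its $n$-fold iterate as a partial function, with $[r]^0$ the identity. A PR-structure is a triple $\Sigma=(\mathsf{P}_\Sigma,\mathsf{R}_\Sigma,\rho^\Sigma)$ where $\mathsf{P}_\Sigma$ and $\mathsf{R}_\Sigma$ are non-empty sets and $\rho^\Sigma:\mathsf{P}_\Sigma\times\mathsf{P}_\Sigma\to\mathcal{P}(\mathsf{R}_\Sigma)$ is a function. For a set $I$ and functions $\varphi,\psi:I\to\mathsf{P}_\Sigma$, write $\varphi\vdash^\Sigma_I\psi$ iff $\bigcap_{i\in I}\rho^\Sigma(\varphi(i),\psi(i))\neq\emptyset$, i.e. iff there is $r\in\mathsf{R}_\Sigma$ with $r\in\rho^\Sigma(\varphi(i),\psi(i))$ for every $i\in I$. $\Sigma$ is posetal if for every set $I$ the relation $\vdash^\Sigma_I$ on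 $\mathsf{P}_\Sigma^I$ is a partial order. The PR-structure associated to $\mathcal{R}$ is $\Sigma[\mathcal{R}]:=(\mathcal{P}(\mathcal{R}),\mathcal{R},\Rightarrow)$ where, for $A,B\subseteq\mathcal{R}$, $A\Rightarrow B:=\{r\in\mathcal{R}\mid \text{for every } a\in A,\ r\cdot a\downarrow \text{ and } r\cdot a\in B\}$. -}

module Defs where

open import Data.Nat.Base using (ℕ; zero; suc)
open import Data.Product.Base using (∃; ∃₂; _×_; _,_)
open import Level using (Level; _⊔_) renaming (suc to lsuc)
open import Relation.Binary.Bundles using (Setoid)
open import Relation.Binary.Core using (Rel; REL)
open import Relation.Binary.PropositionalEquality.Core
  using (_≡_; _≢_; refl)
open import Relation.Binary.Structures using (IsPartialOrder)
open import Relation.Unary using (Pred; _∈_; _≐_)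
open import Relation.Unary.Relation.Binary.Equality using (≐-setoid)

private
  variable
    ℓ : Level

------------------------------------------------------------------------
-- Partial functions

-- A partial function is a single-valued graph. Definedness is not assumed
-- to be decidable, as it would be with functions into Maybe.
record _⇀_ (A B : Set ℓ) : Set (lsuc ℓ) where
  field
    Graph        : REL A B ℓ
    singleValued : ∀ {x y z} → Graph x y → Graph x z → y ≡ z

open _⇀_ public

infix 4 _⟨_⟩↓ _⟨_⟩↦_

_⟨_⟩↦_ : {A B : Set ℓ} → A ⇀ B → A → B → Set ℓ
f ⟨ x ⟩↦ y = Graph f x y

_⟨_⟩↓ : {A B : Set ℓ} → A ⇀ B → A → Set ℓ
f ⟨ x ⟩↓ = ∃ λ y → f ⟨ x ⟩↦ y

-- f(x) ≠ g(x), where asserting this includes that both sides are defined.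
DistinctValues : {A B : Set ℓ} → A ⇀ B → A ⇀ B → A → Set ℓ
DistinctValues f g x = ∃₂ λ y z → f ⟨ x ⟩↦ y × g ⟨ x ⟩↦ z × y ≢ z

idₚ : {A : Set ℓ} → A ⇀ A
idₚ .Graph = _≡_
idₚ .singleValued refl refl = refl

infixr 9 _∘ₚ_

_∘ₚ_ : {A B C : Set ℓ} → B ⇀ C → A ⇀ B → A ⇀ C
(g ∘ₚ f) .Graph x z = ∃ λ y → f ⟨ x ⟩↦ y × g ⟨ y ⟩↦ z
(g ∘ₚ f) .singleValued (_ , fxy , gyz) (_ , fxy′ , gy′z′)
  with refl ← singleValued f fxy fxy′ = singleValued g gyz gy′z′

infixr 10 _^ₚ_

_^ₚ_ : {A : Set ℓ} → A ⇀ A → ℕ → A ⇀ A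
f ^ₚ zero  = idₚ
f ^ₚ suc n = f ∘ₚ f ^ₚ n

------------------------------------------------------------------------
-- Partial applicative structures

record PartialApplicativeStructure (ℓ : Level) : Set (lsuc ℓ) where
  field
    Carrier  : Set ℓ
    nonEmpty : Carrier
    app      : (Carrier × Carrier) ⇀ Carrier

  [_] : Carrier → Carrier ⇀ Carrier
  [ r ] .Graph x y = app ⟨ r , x ⟩↦ y
  [ r ] .singleValued = singleValued app

------------------------------------------------------------------------
-- PR-structures

-- P is a setoid because equality of subsets is extensional equality; the
-- function ρ into the subsets of R must then respect it.
record PRStructure (p e r q : Level) : Set (lsuc (p ⊔ e ⊔ r ⊔ q)) where
  field
    P  : Setoid p e
    R  : Set r

  open Setoid P public using () renaming (Carrier to ∣P∣; _≈_ to _≈ₚ_)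

  field
    P-nonEmpty : ∣P∣
    R-nonEmpty : R
    ρ          : ∣P∣ → ∣P∣ → Pred R q
    ρ-cong     : ∀ {x x′ y y′} → x ≈ₚ x′ → y ≈ₚ y′ → ρ x y ≐ ρ x′ y′

  module _ {i} (I : Set i) where

    Entails : Rel (I → ∣P∣) (i ⊔ r ⊔ q)
    Entails φ ψ = ∃ λ (t : R) → ∀ (j : I) → t ∈ ρ (φ j) (ψ j)

    Pointwise≈ : Rel (I → ∣P∣) (i ⊔ e)
    Pointwise≈ φ ψ = ∀ (j : I) → φ j ≈ₚ ψ j

-- The level i is the universe from which the index sets are drawn.
Posetal : ∀ {p e r q} (i : Level) → PRStructure p e r q →
          Set (lsuc i ⊔ p ⊔ e ⊔ r ⊔ q)
Posetal i Σ = (I : Set i) → IsPartialOrder (Pointwise≈ I) (Entails I)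
  where open PRStructure Σ

------------------------------------------------------------------------
-- The PR-structure associated to a partial applicative structure

module _ (𝓡 : PartialApplicativeStructure ℓ) where

  open PartialApplicativeStructure 𝓡

  Realizers : Pred Carrier ℓ → Pred Carrier ℓ → Pred Carrier ℓ
  Realizers A B r = ∀ {a} → a ∈ A → ∃ λ b → [ r ] ⟨ a ⟩↦ b × b ∈ B

  Σ[_] : PRStructure (lsuc ℓ) ℓ ℓ ℓ
  Σ[_] = record
    { P          = ≐-setoid Carrier ℓ
    ; R          = Carrier
    ; P-nonEmpty = λ x → x ≡ x
    ; R-nonEmpty = nonEmpty
    ; ρ          = Realizers
    ; ρ-cong     = λ (A⊆A′ , A′⊆A) (B⊆B′ , B′⊆B) →
        (λ f a∈A′ → let b , ra↦b , b∈B  = f (A′⊆A a∈A′) in b , ra↦b , B⊆B′ b∈B) ,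
        (λ f a∈A  → let b , ra↦b , b∈B′ = f (A⊆A′ a∈A)  in b , ra↦b , B′⊆B b∈B′)
    }

{-# OPTIONS --safe #-}

-- Suppose every [r]ⁿ(s) is defined. Then r realizes Orbit ⇒ Tail, where
-- Orbit = {[r]ⁿ(s) | n ≥ 0} and Tail = {[r]ⁿ(s) | n ≥ 1} ⊆ Orbit, so the two
-- sets coincide by antisymmetry and s = r · w with w = [r]ᵐ(s) for some m.
-- By transitivity {s} ⊢ {w}, while r gives {w} ⊢ {s}; hence w = s by
-- antisymmetry, and r · s = s. Otherwise take n least with [r]ⁿ(s) undefined:
-- a repetition below n would make [r]ⁿ⁻¹(s) equal to an earlier value, and r
-- is defined on all of those.
module Submission where

open import Defs
open import Axiom.ExcludedMiddle using (ExcludedMiddle)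
open import Data.Nat.Base using (ℕ; zero; suc; _+_; _∸_; _<_; _≤_; s≤s⁻¹)
open import Data.Nat.Properties
  using (m≤n⇒m<n∨m≡n; m∸n+n≡m; +-monoʳ-<; <-cmp)
open import Data.Product.Base using (∃; _×_; _,_; proj₁)
open import Data.Sum.Base using (_⊎_; inj₁; inj₂)
open import Data.Unit.Polymorphic.Base using (⊤; tt)
open import Function.Base using (const)
open import Relation.Binary.Definitions using (tri<; tri≈; tri>)
open import Relation.Binary.PropositionalEquality.Core
  using (_≢_; refl; sym; subst)
open import Relation.Binary.Structures using (IsPartialOrder)
open import Relation.Nullary.Decidable.Core using (yes; no; decidable-stable)
open import Relation.Nullary.Negation.Core using (¬_; contradiction)
open import Relation.Unary using (Pred; _≐_; ｛_｝)

module _ {ℓ} {A : Set ℓ} (f : A ⇀ A) {x : A} where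

  ^ₚ-↓-≤ : ∀ {m n} → m ≤ n → f ^ₚ n ⟨ x ⟩↓ → f ^ₚ m ⟨ x ⟩↓
  ^ₚ-↓-≤ {n = n} m≤n d with m≤n⇒m<n∨m≡n m≤n
  ^ₚ-↓-≤ m≤n d | inj₂ refl = d
  ^ₚ-↓-≤ {n = suc _} m≤n (_ , y , fⁿx↦y , _) | inj₁ m<1+n =
    ^ₚ-↓-≤ (s≤s⁻¹ m<1+n) (y , fⁿx↦y)

  -- Further iteration depends only on the common value `y`, so the starting index can be exchanged.
  ^ₚ-shift : ∀ {i j y z} k → f ^ₚ i ⟨ x ⟩↦ y → f ^ₚ j ⟨ x ⟩↦ y →
             f ^ₚ (k + j) ⟨ x ⟩↦ z → f ^ₚ (k + i) ⟨ x ⟩↦ z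
  ^ₚ-shift {i} {j} zero p q r with refl ← singleValued (f ^ₚ j) q r = p
  ^ₚ-shift (suc k) p q (w , r , fw↦z) = w , ^ₚ-shift k p q r , fw↦z

  -- The search descends from `n` and must stop, since the zeroth iterate is defined. Minimality is
  -- implicit: definedness is inherited downwards by `^ₚ-↓-≤`.
  firstUndefined : ExcludedMiddle ℓ → ∀ n → ¬ (f ^ₚ n ⟨ x ⟩↓) →
                   ∃ λ m → f ^ₚ m ⟨ x ⟩↓ × ¬ (f ^ₚ suc m ⟨ x ⟩↓)
  firstUndefined em zero    u = contradiction (x , refl) u
  firstUndefined em (suc n) u with em {f ^ₚ n ⟨ x ⟩↓}
  ... | yes d = n , d , u
  ... | no u′ = firstUndefined em n u′

  noRepetition : ∀ {m i j y} → f ^ₚ m ⟨ x ⟩↓ → ¬ (f ^ₚ suc m ⟨ x ⟩↓) →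
                 i < j → j ≤ m →
                 f ^ₚ i ⟨ x ⟩↦ y → ¬ (f ^ₚ j ⟨ x ⟩↦ y)
  noRepetition {m} {i} {j} (z , fᵐx↦z) u i<j j≤m p q =
    -- Advancing both equal iterates by `m ∸ j` steps takes index `j` to `m` and index `i` to one
    -- strictly below `m`.
    let k        = m ∸ j
        k+j≡m    = m∸n+n≡m j≤m
        earlier  = ^ₚ-shift k p q (subst (λ n → f ^ₚ n ⟨ x ⟩↦ z) (sym k+j≡m) fᵐx↦z)
        k+i<m    = subst (k + i <_) k+j≡m (+-monoʳ-< k i<j)
        w , fz↦w = next k+i<m earlier
    in u (w , z , fᵐx↦z , fz↦w)
    where
    next : ∀ {n} → n < m → f ^ₚ n ⟨ x ⟩↦ z → f ⟨ z ⟩↓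
    next {n} n<m fⁿx↦z with ^ₚ-↓-≤ n<m (z , fᵐx↦z)
    ... | w , y , fⁿx↦y , fy↦w with refl ← singleValued (f ^ₚ n) fⁿx↦z fⁿx↦y =
      w , fy↦w

  distinctValues : ∀ {m} → f ^ₚ m ⟨ x ⟩↓ → ¬ (f ^ₚ suc m ⟨ x ⟩↓) →
                   ∀ i j → i < suc m → j < suc m → i ≢ j →
                   DistinctValues (f ^ₚ i) (f ^ₚ j) x
  distinctValues d u i j i<1+m j<1+m i≢j =
    let y , p = ^ₚ-↓-≤ (s≤s⁻¹ i<1+m) d
        z , q = ^ₚ-↓-≤ (s≤s⁻¹ j<1+m) d
    in y , z , p , q , λ y≡z → absurd p (subst (f ^ₚ j ⟨ x ⟩↦_) (sym y≡z) q)
    where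
    absurd : ∀ {y} → f ^ₚ i ⟨ x ⟩↦ y → ¬ (f ^ₚ j ⟨ x ⟩↦ y)
    absurd p q with <-cmp i j
    ... | tri< i<j _ _ = noRepetition d u i<j (s≤s⁻¹ j<1+m) p q
    ... | tri≈ _ i≡j _ = i≢j i≡j
    ... | tri> _ _ j<i = noRepetition d u j<i (s≤s⁻¹ i<1+m) q p

module _ {ℓ ι} (𝓡 : PartialApplicativeStructure ℓ) (posetal : Posetal ι Σ[ 𝓡 ]) where

  open PartialApplicativeStructure 𝓡
  private module ⊢ = IsPartialOrder (posetal ⊤)

  infix 4 _⊢_

  -- Over a one-point index set, families are single subsets.
  _⊢_ : Pred Carrier ℓ → Pred Carrier ℓ → Set _
  A ⊢ B = PRStructure.Entails Σ[ 𝓡 ] (⊤ {ι}) (const A) (const B)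

  ⊢-antisym : ∀ {A B} → A ⊢ B → B ⊢ A → A ≐ B
  ⊢-antisym A⊢B B⊢A = ⊢.antisym A⊢B B⊢A tt

  module _ {r s : Carrier} where

    step⇒⊢ : ∀ {x y} → [ r ] ⟨ x ⟩↦ y → ｛ x ｝ ⊢ ｛ y ｝
    step⇒⊢ rx↦y = r , λ _ → λ { refl → _ , rx↦y , refl }

    -- `𝓡` comes with no composition of elements; transitivity supplies one realizer for all `n`
    -- steps.
    iterate⇒⊢ : ∀ n {x} → [ r ] ^ₚ n ⟨ s ⟩↦ x → ｛ s ｝ ⊢ ｛ x ｝
    iterate⇒⊢ zero    refl           = ⊢.refl
    iterate⇒⊢ (suc n) (_ , p , ry↦x) = ⊢.trans (iterate⇒⊢ n p) (step⇒⊢ ry↦x)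

    periodic⇒fixed : ∀ n → [ r ] ^ₚ suc n ⟨ s ⟩↦ s → [ r ] ⟨ s ⟩↦ s
    periodic⇒fixed n (w , p , rw↦s)
      -- The singletons of `s` and `w` coincide, so matching on `refl` identifies `w` with `s`.
      with refl ← proj₁ (⊢-antisym (iterate⇒⊢ n p) (step⇒⊢ rw↦s)) refl = rw↦s

    total⇒periodic : (∀ n → [ r ] ^ₚ n ⟨ s ⟩↓) → ∃ λ n → [ r ] ^ₚ suc n ⟨ s ⟩↦ s
    -- `s` lies in `Orbit` as the zeroth iterate, hence in `Tail`.
    total⇒periodic total = proj₁ (⊢-antisym Orbit⊢Tail Tail⊢Orbit) (0 , refl)
      where
      Orbit Tail : Pred Carrier ℓ
      Orbit x = ∃ λ n → [ r ] ^ₚ n ⟨ s ⟩↦ x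
      Tail  x = ∃ λ n → [ r ] ^ₚ suc n ⟨ s ⟩↦ x

      Orbit⊢Tail : Orbit ⊢ Tail
      Orbit⊢Tail = r , λ _ → step
        where
        step : Realizers 𝓡 Orbit Tail r
        step (n , p) with total (suc n)
        ... | z , y , q , ry↦z with refl ← singleValued ([ r ] ^ₚ n) p q =
          z , ry↦z , n , y , q , ry↦z

      Tail⊢Orbit : Tail ⊢ Orbit
      -- No identity element is given, so the inclusion is realized by whatever `e` reflexivity
      -- provides at `Tail`; its values are then reindexed by `suc`.
      Tail⊢Orbit with e , e∈Tail⇒Tail ← ⊢.refl {const Tail} =
        e , λ _ a∈Tail → let b , ea↦b , n , p = e∈Tail⇒Tail tt a∈Tail
                         in b , ea↦b , suc n , p

theorem3p4 : ∀ {ℓ ι} → ExcludedMiddle ℓ →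
    (𝓡 : PartialApplicativeStructure ℓ) →
    let open PartialApplicativeStructure 𝓡 in
    Posetal ι Σ[ 𝓡 ] →
    (r s : Carrier) →
    ([ r ] ⟨ s ⟩↦ s)
    ⊎ ∃ λ (n : ℕ) →
    ¬ (([ r ] ^ₚ n) ⟨ s ⟩↓)
    × (∀ (i j : ℕ) → i < n → j < n → i ≢ j →
    DistinctValues ([ r ] ^ₚ i) ([ r ] ^ₚ j) s)
theorem3p4 em 𝓡 posetal r s = conclude
  where
  open PartialApplicativeStructure 𝓡

  conclude : _ ⊎ _
  conclude with em {∃ λ n → ¬ ([ r ] ^ₚ n ⟨ s ⟩↓)}
  ... | yes (n , u) =
    let m , d , u′ = firstUndefined [ r ] em n u
    in inj₂ (suc m , u′ , distinctValues [ r ] d u′)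
  ... | no ¬u =
    let n , p = total⇒periodic 𝓡 posetal λ n → decidable-stable em λ u → ¬u (n , u)
    in inj₁ (periodic⇒fixed 𝓡 posetal n p)
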